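{- The rule ($\rho6$): from $(\phi\rightsquigarrow p)\wedge(p\rightsquigarrow\psi)\to\chi$ infer $(\phi\rightsquigarrow\psi)\to\chi$ (where $\phi,\psi,\chi$ are formulas and $p$ is a propositional variable not occurring in $\phi,\psi,\chi$) is admissible in $\mathsf{MS^2IC}$: whenever $(\phi\rightsquigarrow p)\wedge(p\rightsquigarrow\psi)\to\chi$ is a theorem of $\mathsf{MS^2IC}$ with $p$ not occurring in $\phi,\psi,\chi$, so is $(\phi\rightsquigarrow\psi)\to\chi$.
   Context: Language: propositional variables, $\top,\bot$, $\neg,\wedge,\vee,\to,\leftrightarrow$, a binary connective $\rightsquigarrow$ and a unary modality $\Box$; $\Diamond\phi:=\neg\Box\neg\phi$, $[\forall]\phi:=\top\rightsquigarrow\phi$. $\mathsf{MS^2IC}$: theorems are the least set containing all instances of classical tautologies and of (A1) $(\bot\rightsquigarrow\phi)\wedge(\phi\rightsquigarrow\top)$; (A2) $((\phi\vee\psi)\rightsquigarrow\chi)\leftrightarrow((\phi\rightsquigarrow\chi)\wedge(\psi\rightsquigarrow\chi))$; (A3) $(\phi\rightsquigarrow(\psi\wedge\chi))\leftrightarrow((\phi\rightsquigarrow\psi)\wedge(\phi\rightsquigarrow\chi))$; (A4) $(\phi\rightsquigarrow\psi)\to(\phi\to\psi)$; (A5) $(\phi\rightsquigarrow\psi)\leftrightarrow(\neg\psi\rightsquigarrow\neg\phi)$; (A8) $[\forall]\phi\to[\forall][\forall]\phi$; (A9) $\neg[\forall]\phi\to[\forall]\neg[\forall]\phi$; (A10)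 $(\phi\rightsquigarrow\psi)\leftrightarrow[\forall](\phi\rightsquigarrow\psi)$; (A11) $[\forall]\phi\to(\neg[\forall]\phi\rightsquigarrow\bot)$; (K) $\Box(\phi\to\psi)\to(\Box\phi\to\Box\psi)$; (Add) $(\phi\rightsquigarrow\psi)\to(\Box\phi\rightsquigarrow\Box\psi)$; closed under modus ponens, from $\phi$ infer $[\forall]\phi$, from $\phi$ infer $\Box\phi$. -}

module Defs where

open import Data.Nat using (ℕ)
open import Data.Bool using (Bool; true; false; not; _∧_; _∨_)
open import Data.Product using (Σ; _×_; ∃)
open import Relation.Binary.PropositionalEquality using (_≡_)
open import Relation.Nullary using (¬_)

infixr 30 _∧'_
infixr 25 _∨'_
infixr 20 _⇒_ _⇔_
infix 35 _↝_

data Fm : Set where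
  var : ℕ → Fm
  ⊤' ⊥' : Fm
  ¬' : Fm → Fm
  _∧'_ _∨'_ _⇒_ _⇔_ _↝_ : Fm → Fm → Fm
  □ : Fm → Fm

◇ : Fm → Fm
◇ φ = ¬' (□ (¬' φ))

[∀] : Fm → Fm
[∀] φ = ⊤' ↝ φ

data PFm : Set where
  pvar : ℕ → PFm
  p⊤ p⊥ : PFm
  p¬ : PFm → PFm
  _p∧_ _p∨_ _p⇒_ _p⇔_ : PFm → PFm → PFm

evalP : (ℕ → Bool) → PFm → Bool
evalP v (pvar n) = v n
evalP v p⊤ = true
evalP v p⊥ = false
evalP v (p¬ a) = not (evalP v a)
evalP v (a p∧ b) = evalP v a ∧ evalP v b
evalP v (a p∨ b) = evalP v a ∨ evalP v b
evalP v (a p⇒ b) = not (evalP v a) ∨ evalP v b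
evalP v (a p⇔ b) with evalP v a | evalP v b
... | true  | true  = true
... | false | false = true
... | _     | _     = false

Taut : PFm → Set
Taut a = (v : ℕ → Bool) → evalP v a ≡ true

inst : (ℕ → Fm) → PFm → Fm
inst σ (pvar n) = σ n
inst σ p⊤ = ⊤'
inst σ p⊥ = ⊥'
inst σ (p¬ a) = ¬' (inst σ a)
inst σ (a p∧ b) = inst σ a ∧' inst σ b
inst σ (a p∨ b) = inst σ a ∨' inst σ b
inst σ (a p⇒ b) = inst σ a ⇒ inst σ b
inst σ (a p⇔ b) = inst σ a ⇔ inst σ b

data ⊢_ : Fm → Set where
  taut : ∀ (τ : PFm) (σ : ℕ → Fm) → Taut τ → ⊢ inst σ τ
  A1  : ∀ φ → ⊢ ((⊥' ↝ φ) ∧' (φ ↝ ⊤'))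
  A2  : ∀ φ ψ χ → ⊢ (((φ ∨' ψ) ↝ χ) ⇔ ((φ ↝ χ) ∧' (ψ ↝ χ)))
  A3  : ∀ φ ψ χ → ⊢ ((φ ↝ (ψ ∧' χ)) ⇔ ((φ ↝ ψ) ∧' (φ ↝ χ)))
  A4  : ∀ φ ψ → ⊢ ((φ ↝ ψ) ⇒ (φ ⇒ ψ))
  A5  : ∀ φ ψ → ⊢ ((φ ↝ ψ) ⇔ (¬' ψ ↝ ¬' φ))
  A8  : ∀ φ → ⊢ ([∀] φ ⇒ [∀] ([∀] φ))
  A9  : ∀ φ → ⊢ (¬' ([∀] φ) ⇒ [∀] (¬' ([∀] φ)))
  A10 : ∀ φ ψ → ⊢ ((φ ↝ ψ) ⇔ [∀] (φ ↝ ψ))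
  A11 : ∀ φ → ⊢ ([∀] φ ⇒ (¬' ([∀] φ) ↝ ⊥'))
  K   : ∀ φ ψ → ⊢ (□ (φ ⇒ ψ) ⇒ (□ φ ⇒ □ ψ))
  Add : ∀ φ ψ → ⊢ ((φ ↝ ψ) ⇒ (□ φ ↝ □ ψ))
  MP  : ∀ {φ ψ} → ⊢ (φ ⇒ ψ) → ⊢ φ → ⊢ ψ
  Nec∀ : ∀ {φ} → ⊢ φ → ⊢ [∀] φ
  Nec□ : ∀ {φ} → ⊢ φ → ⊢ □ φ

data Occurs (p : ℕ) : Fm → Set where
  here : Occurs p (var p)
  ¬o   : ∀ {a} → Occurs p a → Occurs p (¬' a)
  ∧l : ∀ {a b} → Occurs p a → Occurs p (a ∧' b)
  ∧r : ∀ {a b} → Occurs p b → Occurs p (a ∧' b)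
  ∨l : ∀ {a b} → Occurs p a → Occurs p (a ∨' b)
  ∨r : ∀ {a b} → Occurs p b → Occurs p (a ∨' b)
  ⇒l : ∀ {a b} → Occurs p a → Occurs p (a ⇒ b)
  ⇒r : ∀ {a b} → Occurs p b → Occurs p (a ⇒ b)
  ⇔l : ∀ {a b} → Occurs p a → Occurs p (a ⇔ b)
  ⇔r : ∀ {a b} → Occurs p b → Occurs p (a ⇔ b)
  ↝l : ∀ {a b} → Occurs p a → Occurs p (a ↝ b)
  ↝r : ∀ {a b} → Occurs p b → Occurs p (a ↝ b)
  □o : ∀ {a} → Occurs p a → Occurs p (□ a)

-- The calculus has no congruence rule for ↝: provably equivalent formulas need not be
-- interchangeable in its arguments. A1, A2, A3 and A5 only split a ↝ b into a Boolean combination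
-- of irreducible pairs, and the truth value of ↝ on the latter is almost unconstrained. This leaves
-- room for a translation tr that fixes all p-free formulas, sends p to φ, and reads a ↝ b, when p
-- occurs in it, by splitting it. An irreducible pair containing p becomes
-- ⊤ ↝ ((φ ↝ ψ) ⇒ tr a ⇒ tr b), apart from the four shapes whose value A8-A11 and Add tie to that of
-- a smaller pair. By induction on derivations, ⊢ θ implies ⊢ (φ ↝ ψ) ⇒ tr θ; and the translations
-- of φ ↝ p and p ↝ ψ are theorems, so applying this to the premise of the rule gives the conclusion.
module Submission where

open import Defs
open import Data.Bool using (Bool; true; false; T; _∧_)
open import Data.Bool.Properties using (T-≡; T-∧)
open import Data.List using (List; []; _∷_)
open import Data.Maybe using (Maybe; just; nothing)
open import Data.Nat using (ℕ; zero; suc; _≟_)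
open import Data.Product using (_×_; _,_; proj₁; proj₂)
open import Data.Sum using (inj₁; inj₂; [_,_]′)
open import Data.Vec using (Vec; []; _∷_)
open import Function using (_∘_)
open import Function.Bundles using (module Equivalence)
open import Relation.Binary.PropositionalEquality
  using (_≡_; refl; sym; trans; cong; cong₂; subst)
open import Relation.Nullary using (¬_; Dec; yes; no; contradiction)
open import Relation.Nullary.Decidable using (map′; _⊎-dec_)

open import Defs using () renaming
  ( pvar to infix 40 #_; p⊤ to ⊤ₚ; p⊥ to ⊥ₚ; p¬ to ¬ₚ
  ; _p∧_ to infixr 30 _∧ₚ_; _p∨_ to infixr 25 _∨ₚ_
  ; _p⇒_ to infixr 20 _⇒ₚ_; _p⇔_ to infixr 20 _⇔ₚ_)

-- Deciding tautologies by truth tables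

override : ∀ {k} → Vec Bool k → (ℕ → Bool) → ℕ → Bool
override []       v n       = v n
override (x ∷ _)  v zero    = x
override (_ ∷ xs) v (suc n) = override xs (v ∘ suc) n

restrict : ∀ k → (ℕ → Bool) → Vec Bool k
restrict zero    v = []
restrict (suc k) v = v 0 ∷ restrict k (v ∘ suc)

override-restrict : ∀ k v n → override (restrict k v) v n ≡ v n
override-restrict zero    v n       = refl
override-restrict (suc k) v zero    = refl
override-restrict (suc k) v (suc n) = override-restrict k (v ∘ suc) n

evalP-ext : ∀ {v w} → (∀ n → v n ≡ w n) → ∀ τ → evalP v τ ≡ evalP w τ
evalP-ext e (# n) = e n
evalP-ext e ⊤ₚ = refl
evalP-ext e ⊥ₚ = refl
evalP-ext e (¬ₚ a) rewrite evalP-ext e a = refl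
evalP-ext e (a ∧ₚ b) rewrite evalP-ext e a | evalP-ext e b = refl
evalP-ext e (a ∨ₚ b) rewrite evalP-ext e a | evalP-ext e b = refl
evalP-ext e (a ⇒ₚ b) rewrite evalP-ext e a | evalP-ext e b = refl
evalP-ext e (a ⇔ₚ b) rewrite evalP-ext e a | evalP-ext e b = refl

everywhere : ∀ k → (Vec Bool k → Bool) → Bool
everywhere zero    f = f []
everywhere (suc k) f = everywhere k (f ∘ (true ∷_)) ∧ everywhere k (f ∘ (false ∷_))

everywhere-sound : ∀ k f → T (everywhere k f) → ∀ xs → T (f xs)
everywhere-sound zero    f ok [] = ok
everywhere-sound (suc k) f ok (true ∷ xs) =
  everywhere-sound k _ (proj₁ (Equivalence.to T-∧ ok)) xs
everywhere-sound (suc k) f ok (false ∷ xs) =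
  everywhere-sound k _ (proj₂ (Equivalence.to T-∧ ok)) xs

nth : List Fm → ℕ → Fm
nth []       _       = ⊤'
nth (A ∷ _)  zero    = A
nth (_ ∷ As) (suc n) = nth As n

-- The check is made for an unknown v, so it can only succeed if # 0, …, # (k - 1) are the only
-- variables that matter.
tautology : ∀ k τ As →
  (∀ v → T (everywhere k λ xs → evalP (override xs v) τ)) → ⊢ inst (nth As) τ
tautology k τ As ok = taut τ (nth As) λ v →
  trans (sym (evalP-ext (override-restrict k v) τ))
        (Equivalence.to T-≡ (everywhere-sound k _ (ok v) (restrict k v)))

-- Propositional derived rules

MP₂ : ∀ {A B C} → ⊢ (A ⇒ B ⇒ C) → ⊢ A → ⊢ B → ⊢ C
MP₂ f a b = MP (MP f a) b

⊢⊤ : ⊢ ⊤'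
⊢⊤ = tautology 0 ⊤ₚ [] _

weaken : ∀ {A B} → ⊢ B → ⊢ (A ⇒ B)
weaken {A} {B} = MP (tautology 2 (# 1 ⇒ₚ # 0 ⇒ₚ # 1) (A ∷ B ∷ []) _)

⇒-refl : ∀ {A} → ⊢ (A ⇒ A)
⇒-refl {A} = tautology 1 (# 0 ⇒ₚ # 0) (A ∷ []) _

⇔-refl : ∀ {A} → ⊢ (A ⇔ A)
⇔-refl {A} = tautology 1 (# 0 ⇔ₚ # 0) (A ∷ []) _

⇒-trans : ∀ {A B C} → ⊢ (A ⇒ B) → ⊢ (B ⇒ C) → ⊢ (A ⇒ C)
⇒-trans {A} {B} {C} = MP₂ (tautology 3
  ((# 0 ⇒ₚ # 1) ⇒ₚ (# 1 ⇒ₚ # 2) ⇒ₚ # 0 ⇒ₚ # 2) (A ∷ B ∷ C ∷ []) _)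

⇒-app : ∀ {A B C} → ⊢ (A ⇒ B ⇒ C) → ⊢ (A ⇒ B) → ⊢ (A ⇒ C)
⇒-app {A} {B} {C} = MP₂ (tautology 3
  ((# 0 ⇒ₚ # 1 ⇒ₚ # 2) ⇒ₚ (# 0 ⇒ₚ # 1) ⇒ₚ # 0 ⇒ₚ # 2) (A ∷ B ∷ C ∷ []) _)

⇒-swap : ∀ {A B C} → ⊢ (A ⇒ B ⇒ C) → ⊢ (B ⇒ A ⇒ C)
⇒-swap {A} {B} {C} = MP (tautology 3
  ((# 0 ⇒ₚ # 1 ⇒ₚ # 2) ⇒ₚ # 1 ⇒ₚ # 0 ⇒ₚ # 2) (A ∷ B ∷ C ∷ []) _)

⇒-trans₂ : ∀ {A B C D} → ⊢ (A ⇒ B ⇒ C) → ⊢ (C ⇒ D) → ⊢ (A ⇒ B ⇒ D)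
⇒-trans₂ {A} {B} {C} {D} = MP₂ (tautology 4
  ((# 0 ⇒ₚ # 1 ⇒ₚ # 2) ⇒ₚ (# 2 ⇒ₚ # 3) ⇒ₚ # 0 ⇒ₚ # 1 ⇒ₚ # 3) (A ∷ B ∷ C ∷ D ∷ []) _)

⊢⇒⇔⊤ : ∀ {A} → ⊢ A → ⊢ (A ⇔ ⊤')
⊢⇒⇔⊤ {A} = MP (tautology 1 (# 0 ⇒ₚ (# 0 ⇔ₚ ⊤ₚ)) (A ∷ []) _)

⇔-to : ∀ {A B} → ⊢ (A ⇔ B) → ⊢ (A ⇒ B)
⇔-to {A} {B} = MP (tautology 2 ((# 0 ⇔ₚ # 1) ⇒ₚ # 0 ⇒ₚ # 1) (A ∷ B ∷ []) _)

contrapose : ∀ {A B} → ⊢ (A ⇒ B) → ⊢ (¬' B ⇒ ¬' A)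
contrapose {A} {B} = MP (tautology 2 ((# 0 ⇒ₚ # 1) ⇒ₚ ¬ₚ (# 1) ⇒ₚ ¬ₚ (# 0)) (A ∷ B ∷ []) _)

∧-intro : ∀ {A B} → ⊢ A → ⊢ B → ⊢ (A ∧' B)
∧-intro {A} {B} = MP₂ (tautology 2 (# 0 ⇒ₚ # 1 ⇒ₚ # 0 ∧ₚ # 1) (A ∷ B ∷ []) _)

∧-intro-⇒ : ∀ {A B C} → ⊢ (A ⇒ B) → ⊢ (A ⇒ C) → ⊢ (A ⇒ (B ∧' C))
∧-intro-⇒ {A} {B} {C} = MP₂ (tautology 3
  ((# 0 ⇒ₚ # 1) ⇒ₚ (# 0 ⇒ₚ # 2) ⇒ₚ # 0 ⇒ₚ # 1 ∧ₚ # 2) (A ∷ B ∷ C ∷ []) _)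

∧-fst : ∀ {A B} → ⊢ ((A ∧' B) ⇒ A)
∧-fst {A} {B} = tautology 2 (# 0 ∧ₚ # 1 ⇒ₚ # 0) (A ∷ B ∷ []) _

∧-snd : ∀ {A B} → ⊢ ((A ∧' B) ⇒ B)
∧-snd {A} {B} = tautology 2 (# 0 ∧ₚ # 1 ⇒ₚ # 1) (A ∷ B ∷ []) _

∨-inl : ∀ {A B} → ⊢ (A ⇒ (A ∨' B))
∨-inl {A} {B} = tautology 2 (# 0 ⇒ₚ # 0 ∨ₚ # 1) (A ∷ B ∷ []) _

∨-inr : ∀ {A B} → ⊢ (B ⇒ (A ∨' B))
∨-inr {A} {B} = tautology 2 (# 1 ⇒ₚ # 0 ∨ₚ # 1) (A ∷ B ∷ []) _

∧-cong-interchange : ∀ {X Y A B C D} →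
  ⊢ (X ⇔ (A ∧' B)) → ⊢ (Y ⇔ (C ∧' D)) → ⊢ ((X ∧' Y) ⇔ ((A ∧' C) ∧' (B ∧' D)))
∧-cong-interchange {X} {Y} {A} {B} {C} {D} = MP₂ (tautology 6
  ((# 0 ⇔ₚ # 2 ∧ₚ # 3) ⇒ₚ (# 1 ⇔ₚ # 4 ∧ₚ # 5) ⇒ₚ
    (# 0 ∧ₚ # 1 ⇔ₚ (# 2 ∧ₚ # 4) ∧ₚ # 3 ∧ₚ # 5))
  (X ∷ Y ∷ A ∷ B ∷ C ∷ D ∷ []) _)

∧-cong : ∀ {X Y A B} → ⊢ (X ⇔ A) → ⊢ (Y ⇔ B) → ⊢ ((X ∧' Y) ⇔ (A ∧' B))
∧-cong {X} {Y} {A} {B} = MP₂ (tautology 4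
  ((# 0 ⇔ₚ # 2) ⇒ₚ (# 1 ⇔ₚ # 3) ⇒ₚ (# 0 ∧ₚ # 1 ⇔ₚ # 2 ∧ₚ # 3)) (X ∷ Y ∷ A ∷ B ∷ []) _)

⇔-join : ∀ {A B C} → ⊢ (A ⇔ C) → ⊢ (B ⇔ C) → ⊢ (A ⇔ B)
⇔-join {A} {B} {C} = MP₂ (tautology 3
  ((# 0 ⇔ₚ # 2) ⇒ₚ (# 1 ⇔ₚ # 2) ⇒ₚ (# 0 ⇔ₚ # 1)) (A ∷ B ∷ C ∷ []) _)

-- Persistence of ↝ under □

□-mono : ∀ {A B} → ⊢ (A ⇒ B) → ⊢ (□ A ⇒ □ B)
□-mono f = MP (K _ _) (Nec□ f)

□-mono₂ : ∀ {A B C} → ⊢ (A ⇒ B ⇒ C) → ⊢ (□ A ⇒ □ B ⇒ □ C)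
□-mono₂ f = ⇒-trans (□-mono f) (K _ _)

-- Add with left argument `⊤'` gives `□ ⊤' ↝ □ A`. A4 turns this into an implication, and `□ ⊤'` is
-- a theorem.
[∀]⇒□ : ∀ A → ⊢ ([∀] A ⇒ □ A)
[∀]⇒□ A = ⇒-app (⇒-trans (Add ⊤' A) (A4 (□ ⊤') (□ A))) (weaken (Nec□ ⊢⊤))

-- Needed for A4 at `□ a ↝ □ b`, whose translation is that of `a ↝ b` and so has to imply its own
-- box. The negative half is carried along because translations may contain negations and must stay
-- persistent under them.
Persistent : Fm → Set
Persistent A = ⊢ (A ⇒ □ A) × ⊢ (¬' A ⇒ □ (¬' A))

-- Positively, A10 gives `[∀] X`, hence `□ X`. Negatively, `X` and `[∀] X` are equivalent, so A9
-- supplies `[∀]` of the negation, which is boxed in the same way.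
↝-persistent : ∀ a b → Persistent (a ↝ b)
↝-persistent a b = ⇒-trans ↝⇒[∀]↝ ([∀]⇒□ X) ,
  ⇒-trans (contrapose [∀]↝⇒↝)
    (⇒-trans (A9 X) (⇒-trans ([∀]⇒□ (¬' ([∀] X))) (□-mono (contrapose ↝⇒[∀]↝))))
  where
  X = a ↝ b
  ↝⇒[∀]↝ : ⊢ (X ⇒ [∀] X)
  ↝⇒[∀]↝ = ⇔-to (A10 a b)
  [∀]↝⇒↝ : ⊢ ([∀] X ⇒ X)
  [∀]↝⇒↝ = ⇒-app (A4 ⊤' X) (weaken ⊢⊤)

⊤-persistent : Persistent ⊤'
⊤-persistent = weaken (Nec□ ⊢⊤) , tautology 1 (¬ₚ ⊤ₚ ⇒ₚ # 0) (□ (¬' ⊤') ∷ []) _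

¬-persistent : ∀ {A} → Persistent A → Persistent (¬' A)
¬-persistent {A} (pos , neg) = neg ,
  ⇒-trans (tautology 1 (¬ₚ (¬ₚ (# 0)) ⇒ₚ # 0) (A ∷ []) _)
    (⇒-trans pos (□-mono (tautology 1 (# 0 ⇒ₚ ¬ₚ (¬ₚ (# 0))) (A ∷ []) _)))

∧-persistent : ∀ {A B} → Persistent A → Persistent B → Persistent (A ∧' B)
∧-persistent {A} {B} (pos , neg) (pos′ , neg′) =
  ⇒-app (⇒-trans ∧-fst (⇒-trans pos
          (□-mono₂ (tautology 2 (# 0 ⇒ₚ # 1 ⇒ₚ # 0 ∧ₚ # 1) (A ∷ B ∷ []) _))))
        (⇒-trans ∧-snd pos′) ,
  MP₂ (tautology 3 ((¬ₚ (# 0) ⇒ₚ # 2) ⇒ₚ (¬ₚ (# 1) ⇒ₚ # 2) ⇒ₚ ¬ₚ (# 0 ∧ₚ # 1) ⇒ₚ # 2)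
        (A ∷ B ∷ □ (¬' (A ∧' B)) ∷ []) _)
    (⇒-trans neg (□-mono (contrapose ∧-fst)))
    (⇒-trans neg′ (□-mono (contrapose ∧-snd)))

-- Decidability of occurrence

occurs? : ∀ p a → Dec (Occurs p a)
occurs? p (var n) = map′ (λ { refl → here }) (λ { here → refl }) (p ≟ n)
occurs? p ⊤' = no λ ()
occurs? p ⊥' = no λ ()
occurs? p (¬' a) = map′ ¬o (λ { (¬o o) → o }) (occurs? p a)
occurs? p (a ∧' b) = map′ [ ∧l , ∧r ]′ (λ { (∧l o) → inj₁ o ; (∧r o) → inj₂ o })
  (occurs? p a ⊎-dec occurs? p b)
occurs? p (a ∨' b) = map′ [ ∨l , ∨r ]′ (λ { (∨l o) → inj₁ o ; (∨r o) → inj₂ o })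
  (occurs? p a ⊎-dec occurs? p b)
occurs? p (a ⇒ b) = map′ [ ⇒l , ⇒r ]′ (λ { (⇒l o) → inj₁ o ; (⇒r o) → inj₂ o })
  (occurs? p a ⊎-dec occurs? p b)
occurs? p (a ⇔ b) = map′ [ ⇔l , ⇔r ]′ (λ { (⇔l o) → inj₁ o ; (⇔r o) → inj₂ o })
  (occurs? p a ⊎-dec occurs? p b)
occurs? p (a ↝ b) = map′ [ ↝l , ↝r ]′ (λ { (↝l o) → inj₁ o ; (↝r o) → inj₂ o })
  (occurs? p a ⊎-dec occurs? p b)
occurs? p (□ a) = map′ □o (λ { (□o o) → o }) (occurs? p a)

-- The translation

-- The pairs whose value is dictated by smaller ones: `⊥-left` and `⊤-right` by A1, `∨-left` by A2,
-- `∧-right` by A3, `¬-both` by A5, `□-both` by Add, `[∀]↝` by A8 and A10, `[∀]¬[∀]` by A9,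
-- `¬[∀]-refuted` by A11.
data Special : Fm → Fm → Set where
  ⊥-left       : ∀ {b} → Special ⊥' b
  ∨-left       : ∀ {a a′ b} → Special (a ∨' a′) b
  ⊤-right      : ∀ {a} → Special a ⊤'
  ∧-right      : ∀ {a b b′} → Special a (b ∧' b′)
  ¬-both       : ∀ {a b} → Special (¬' a) (¬' b)
  □-both       : ∀ {a b} → Special (□ a) (□ b)
  [∀]↝         : ∀ {c d} → Special ⊤' (c ↝ d)
  [∀]¬[∀]      : ∀ {c} → Special ⊤' (¬' ([∀] c))
  ¬[∀]-refuted : ∀ {c} → Special (¬' ([∀] c)) ⊥'

-- Three separate tests, so that `specialˡ` and `specialʳ` each compute from one argument while the
-- other is a variable. The equations stored in `other` then become absurd for every special shape,
-- and coverage checking discards that case.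
specialˡ : ∀ a b → Maybe (Special a b)
specialˡ ⊥'       b = just ⊥-left
specialˡ (_ ∨' _) b = just ∨-left
specialˡ _        b = nothing

specialʳ : ∀ a b → Maybe (Special a b)
specialʳ a ⊤'       = just ⊤-right
specialʳ a (_ ∧' _) = just ∧-right
specialʳ a _        = nothing

special₂ : ∀ a b → Maybe (Special a b)
special₂ (¬' _)        (¬' _)        = just ¬-both
special₂ (□ _)         (□ _)         = just □-both
special₂ ⊤'            (_ ↝ _)       = just [∀]↝
special₂ ⊤'            (¬' (⊤' ↝ _)) = just [∀]¬[∀]
special₂ (¬' (⊤' ↝ _)) ⊥'            = just ¬[∀]-refuted
special₂ _             _             = nothing

module Translation (p : ℕ) (φ ψ : Fm) where

  h : Fm
  h = φ ↝ ψ

  data View (a b : Fm) : Set where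
    free    : ¬ Occurs p a → ¬ Occurs p b → View a b
    special : Special a b → View a b
    other   : specialˡ a b ≡ nothing → specialʳ a b ≡ nothing → special₂ a b ≡ nothing →
              View a b

  view : ∀ a b → View a b
  view a b with occurs? p (a ↝ b)
  ... | no ∉ = free (∉ ∘ ↝l) (∉ ∘ ↝r)
  ... | yes _ with specialˡ a b in eqˡ | specialʳ a b in eqʳ | special₂ a b in eq₂
  ... | just s  | _       | _       = special s
  ... | nothing | just s  | _       = special s
  ... | nothing | nothing | just s  = special s
  ... | nothing | nothing | nothing = other eqˡ eqʳ eq₂

  tr : Fm → Fm
  D : Fm → Fm → Fm
  Dᵛ : ∀ a b → View a b → Fm

  tr (var n) with p ≟ n
  ... | yes _ = φ
  ... | no _ = var n
  tr ⊤' = ⊤'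
  tr ⊥' = ⊥'
  tr (¬' a) = ¬' (tr a)
  tr (a ∧' b) = tr a ∧' tr b
  tr (a ∨' b) = tr a ∨' tr b
  tr (a ⇒ b) = tr a ⇒ tr b
  tr (a ⇔ b) = tr a ⇔ tr b
  tr (a ↝ b) = D a b
  tr (□ a) = □ (tr a)

  D a b = Dᵛ a b (view a b)

  Dᵛ a b (free _ _) = a ↝ b
  Dᵛ .⊥' b (special ⊥-left) = ⊤'
  Dᵛ .(a ∨' a′) b (special (∨-left {a} {a′})) = D a b ∧' D a′ b
  Dᵛ a .⊤' (special ⊤-right) = ⊤'
  Dᵛ a .(b ∧' b′) (special (∧-right {b = b} {b′})) = D a b ∧' D a b′
  Dᵛ .(¬' a) .(¬' b) (special (¬-both {a} {b})) = D b a
  Dᵛ .(□ a) .(□ b) (special (□-both {a} {b})) = D a b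
  Dᵛ .⊤' .(c ↝ d) (special ([∀]↝ {c} {d})) = D c d
  Dᵛ .⊤' .(¬' ([∀] c)) (special ([∀]¬[∀] {c})) = ¬' (D ⊤' c)
  Dᵛ .(¬' ([∀] c)) .⊥' (special (¬[∀]-refuted {c})) = D ⊤' c
  -- The guard `h` makes the translation of `var p ↝ ψ` provable, and it lets `Nec∀` be applied to a
  -- statement proved only under the hypothesis `h`.
  Dᵛ a b (other _ _ _) = [∀] (h ⇒ tr a ⇒ tr b)

  -- Formulas fixed by the translation, and Boolean connectives

  D-free : ∀ {a b} → ¬ Occurs p a → ¬ Occurs p b → D a b ≡ a ↝ b
  D-free {a} {b} ∉a ∉b with occurs? p (a ↝ b)
  ... | no _ = refl
  ... | yes (↝l o) = contradiction o ∉a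
  ... | yes (↝r o) = contradiction o ∉b

  tr-free : ∀ a → ¬ Occurs p a → tr a ≡ a
  tr-free (var n) ∉ with p ≟ n
  ... | yes refl = contradiction here ∉
  ... | no _ = refl
  tr-free ⊤' ∉ = refl
  tr-free ⊥' ∉ = refl
  tr-free (¬' a) ∉ = cong ¬' (tr-free a (∉ ∘ ¬o))
  tr-free (a ∧' b) ∉ = cong₂ _∧'_ (tr-free a (∉ ∘ ∧l)) (tr-free b (∉ ∘ ∧r))
  tr-free (a ∨' b) ∉ = cong₂ _∨'_ (tr-free a (∉ ∘ ∨l)) (tr-free b (∉ ∘ ∨r))
  tr-free (a ⇒ b) ∉ = cong₂ _⇒_ (tr-free a (∉ ∘ ⇒l)) (tr-free b (∉ ∘ ⇒r))
  tr-free (a ⇔ b) ∉ = cong₂ _⇔_ (tr-free a (∉ ∘ ⇔l)) (tr-free b (∉ ∘ ⇔r))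
  tr-free (a ↝ b) ∉ = D-free (∉ ∘ ↝l) (∉ ∘ ↝r)
  tr-free (□ a) ∉ = cong □ (tr-free a (∉ ∘ □o))

  tr-var-p : tr (var p) ≡ φ
  tr-var-p with p ≟ p
  ... | yes _ = refl
  ... | no p≢p = contradiction refl p≢p

  tr-inst : ∀ σ τ → tr (inst σ τ) ≡ inst (tr ∘ σ) τ
  tr-inst σ (# n) = refl
  tr-inst σ ⊤ₚ = refl
  tr-inst σ ⊥ₚ = refl
  tr-inst σ (¬ₚ a) = cong ¬' (tr-inst σ a)
  tr-inst σ (a ∧ₚ b) = cong₂ _∧'_ (tr-inst σ a) (tr-inst σ b)
  tr-inst σ (a ∨ₚ b) = cong₂ _∨'_ (tr-inst σ a) (tr-inst σ b)
  tr-inst σ (a ⇒ₚ b) = cong₂ _⇒_ (tr-inst σ a) (tr-inst σ b)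
  tr-inst σ (a ⇔ₚ b) = cong₂ _⇔_ (tr-inst σ a) (tr-inst σ b)

  -- Stated for an arbitrary view, here and below, so that proofs can match on it without unfolding
  -- the decision procedures inside view a b.
  D-persistent : ∀ a b (v : View a b) → Persistent (Dᵛ a b v)
  D-persistent a b (free _ _) = ↝-persistent a b
  D-persistent ⊥' b (special ⊥-left) = ⊤-persistent
  D-persistent (a ∨' a′) b (special ∨-left) =
    ∧-persistent (D-persistent a b (view _ _)) (D-persistent a′ b (view _ _))
  D-persistent a ⊤' (special ⊤-right) = ⊤-persistent
  D-persistent a (b ∧' b′) (special ∧-right) =
    ∧-persistent (D-persistent a b (view _ _)) (D-persistent a b′ (view _ _))
  D-persistent (¬' a) (¬' b) (special ¬-both) = D-persistent b a (view _ _)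
  D-persistent (□ a) (□ b) (special □-both) = D-persistent a b (view _ _)
  D-persistent ⊤' (c ↝ d) (special [∀]↝) = D-persistent c d (view _ _)
  D-persistent ⊤' (¬' (⊤' ↝ c)) (special [∀]¬[∀]) = ¬-persistent (D-persistent ⊤' c (view _ _))
  D-persistent (¬' (⊤' ↝ c)) ⊥' (special ¬[∀]-refuted) = D-persistent ⊤' c (view _ _)
  D-persistent a b (other _ _ _) = ↝-persistent ⊤' (h ⇒ tr a ⇒ tr b)

  -- Translations of the axioms

  D-⊥ : ∀ b (v : View ⊥' b) → ⊢ Dᵛ ⊥' b v
  D-⊥ b (free _ _) = MP ∧-fst (A1 b)
  D-⊥ b (special ⊥-left) = ⊢⊤
  D-⊥ ⊤' (special ⊤-right) = ⊢⊤
  D-⊥ (b ∧' b′) (special ∧-right) = ∧-intro (D-⊥ b (view _ _)) (D-⊥ b′ (view _ _))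

  D-⊤ : ∀ a (v : View a ⊤') → ⊢ Dᵛ a ⊤' v
  D-⊤ a (free _ _) = MP ∧-snd (A1 a)
  D-⊤ ⊥' (special ⊥-left) = ⊢⊤
  D-⊤ (a ∨' a′) (special ∨-left) = ∧-intro (D-⊤ a (view _ _)) (D-⊤ a′ (view _ _))
  D-⊤ a (special ⊤-right) = ⊢⊤

  -- A disjunction on the left and a conjunction on the right can both be split, and the view fixes
  -- only one order. Both orders lead to the same four pairs, so the two lemmas are proved by mutual
  -- induction.
  D-∨ : ∀ a a′ b (v : View (a ∨' a′) b) → ⊢ (Dᵛ (a ∨' a′) b v ⇔ (D a b ∧' D a′ b))
  D-∧ : ∀ a b b′ (v : View a (b ∧' b′)) → ⊢ (Dᵛ a (b ∧' b′) v ⇔ (D a b ∧' D a b′))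

  D-∨ a a′ b (free ∉ ∉b)
    rewrite D-free (∉ ∘ ∨l) ∉b | D-free (∉ ∘ ∨r) ∉b = A2 a a′ b
  D-∨ a a′ b (special ∨-left) = ⇔-refl
  D-∨ a a′ ⊤' (special ⊤-right) =
    ⇔-join ⇔-refl (⊢⇒⇔⊤ (∧-intro (D-⊤ a (view _ _)) (D-⊤ a′ (view _ _))))
  D-∨ a a′ (b ∧' b′) (special ∧-right) =
    ⇔-join (∧-cong-interchange (D-∨ a a′ b (view _ _)) (D-∨ a a′ b′ (view _ _)))
           (∧-cong (D-∧ a b b′ (view _ _)) (D-∧ a′ b b′ (view _ _)))

  D-∧ a b b′ (free ∉a ∉)
    rewrite D-free ∉a (∉ ∘ ∧l) | D-free ∉a (∉ ∘ ∧r) = A3 a b b′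
  D-∧ ⊥' b b′ (special ⊥-left) =
    ⇔-join ⇔-refl (⊢⇒⇔⊤ (∧-intro (D-⊥ b (view _ _)) (D-⊥ b′ (view _ _))))
  D-∧ (a ∨' a′) b b′ (special ∨-left) =
    ⇔-join (∧-cong-interchange (D-∧ a b b′ (view _ _)) (D-∧ a′ b b′ (view _ _)))
           (∧-cong (D-∨ a a′ b (view _ _)) (D-∨ a a′ b′ (view _ _)))
  D-∧ a b b′ (special ∧-right) = ⇔-refl

  D-contra : ∀ a b (v : View (¬' b) (¬' a)) → ⊢ (D a b ⇔ Dᵛ (¬' b) (¬' a) v)
  D-contra a b (free ∉b ∉a) rewrite D-free (∉a ∘ ¬o) (∉b ∘ ¬o) = A5 a b
  D-contra a b (special ¬-both) = ⇔-refl

  D-□ : ∀ a b (v : View (□ a) (□ b)) → ⊢ (D a b ⇒ Dᵛ (□ a) (□ b) v)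
  D-□ a b (free ∉a ∉b) rewrite D-free (∉a ∘ □o) (∉b ∘ □o) = Add a b
  D-□ a b (special □-both) = ⇒-refl

  D-[∀]↝ : ∀ a b (v : View ⊤' (a ↝ b)) → ⊢ (D a b ⇔ Dᵛ ⊤' (a ↝ b) v)
  D-[∀]↝ a b (free _ ∉) rewrite D-free (∉ ∘ ↝l) (∉ ∘ ↝r) = A10 a b
  D-[∀]↝ a b (special [∀]↝) = ⇔-refl

  D-[∀]¬[∀] : ∀ a (v : View ⊤' (¬' ([∀] a))) → ⊢ (¬' (D ⊤' a) ⇒ Dᵛ ⊤' (¬' ([∀] a)) v)
  D-[∀]¬[∀] a (free ∉⊤ ∉) rewrite D-free ∉⊤ (∉ ∘ ¬o ∘ ↝r) = A9 a
  D-[∀]¬[∀] a (special [∀]¬[∀]) = ⇒-refl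

  D-¬[∀]-refuted : ∀ a (v : View (¬' ([∀] a)) ⊥') → ⊢ (D ⊤' a ⇒ Dᵛ (¬' ([∀] a)) ⊥' v)
  D-¬[∀]-refuted a (free ∉ ∉⊥) rewrite D-free {⊤'} (λ ()) (∉ ∘ ¬o ∘ ↝r) = A11 a
  D-¬[∀]-refuted a (special ¬[∀]-refuted) = ⇒-refl

  h-persistent : ⊢ (h ⇒ □ h)
  h-persistent = proj₁ (↝-persistent φ ψ)

  -- This is A4 after translation. Irreducible pairs carry the guard `h`, so the implication can be
  -- claimed only under `h`.
  D-reflexive : ∀ a b (v : View a b) → ⊢ (h ⇒ Dᵛ a b v ⇒ tr a ⇒ tr b)
  D-reflexive a b (free ∉a ∉b) rewrite tr-free a ∉a | tr-free b ∉b = weaken (A4 a b)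
  D-reflexive ⊥' b (special ⊥-left) =
    tautology 2 (# 0 ⇒ₚ ⊤ₚ ⇒ₚ ⊥ₚ ⇒ₚ # 1) (h ∷ tr b ∷ []) _
  D-reflexive (a ∨' a′) b (special ∨-left) =
    MP₂ (tautology 6
      ((# 0 ⇒ₚ # 1 ⇒ₚ # 2 ⇒ₚ # 5) ⇒ₚ (# 0 ⇒ₚ # 3 ⇒ₚ # 4 ⇒ₚ # 5) ⇒ₚ
        # 0 ⇒ₚ # 1 ∧ₚ # 3 ⇒ₚ # 2 ∨ₚ # 4 ⇒ₚ # 5)
      (h ∷ D a b ∷ tr a ∷ D a′ b ∷ tr a′ ∷ tr b ∷ []) _)
      (D-reflexive a b (view _ _)) (D-reflexive a′ b (view _ _))
  D-reflexive a ⊤' (special ⊤-right) =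
    tautology 2 (# 0 ⇒ₚ ⊤ₚ ⇒ₚ # 1 ⇒ₚ ⊤ₚ) (h ∷ tr a ∷ []) _
  D-reflexive a (b ∧' b′) (special ∧-right) =
    MP₂ (tautology 6
      ((# 0 ⇒ₚ # 1 ⇒ₚ # 5 ⇒ₚ # 2) ⇒ₚ (# 0 ⇒ₚ # 3 ⇒ₚ # 5 ⇒ₚ # 4) ⇒ₚ
        # 0 ⇒ₚ # 1 ∧ₚ # 3 ⇒ₚ # 5 ⇒ₚ # 2 ∧ₚ # 4)
      (h ∷ D a b ∷ tr b ∷ D a b′ ∷ tr b′ ∷ tr a ∷ []) _)
      (D-reflexive a b (view _ _)) (D-reflexive a b′ (view _ _))
  D-reflexive (¬' a) (¬' b) (special ¬-both) =
    MP (tautology 4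
      ((# 0 ⇒ₚ # 1 ⇒ₚ # 2 ⇒ₚ # 3) ⇒ₚ # 0 ⇒ₚ # 1 ⇒ₚ ¬ₚ (# 3) ⇒ₚ ¬ₚ (# 2))
      (h ∷ D b a ∷ tr b ∷ tr a ∷ []) _)
      (D-reflexive b a (view _ _))
  D-reflexive (□ a) (□ b) (special □-both) =
    -- Boxing the induction hypothesis leaves the antecedents `□ h` and `□ (D a b)`; persistence
    -- recovers them from `h` and `D a b`.
    ⇒-trans h-persistent (⇒-swap (⇒-trans (proj₁ (D-persistent a b (view a b)))
      (⇒-swap (⇒-trans₂ (□-mono₂ (D-reflexive a b (view a b))) (K (tr a) (tr b))))))
  D-reflexive ⊤' (c ↝ d) (special [∀]↝) =
    tautology 2 (# 0 ⇒ₚ # 1 ⇒ₚ ⊤ₚ ⇒ₚ # 1) (h ∷ D c d ∷ []) _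
  D-reflexive ⊤' (¬' (⊤' ↝ c)) (special [∀]¬[∀]) =
    tautology 2 (# 0 ⇒ₚ # 1 ⇒ₚ ⊤ₚ ⇒ₚ # 1) (h ∷ ¬' (D ⊤' c) ∷ []) _
  D-reflexive (¬' (⊤' ↝ c)) ⊥' (special ¬[∀]-refuted) =
    tautology 2 (# 0 ⇒ₚ # 1 ⇒ₚ ¬ₚ (# 1) ⇒ₚ ⊥ₚ) (h ∷ D ⊤' c ∷ []) _
  D-reflexive a b (other _ _ _) =
    ⇒-swap (⇒-app (A4 ⊤' (h ⇒ tr a ⇒ tr b)) (weaken ⊢⊤))

  -- Soundness of the translation

  -- Both derivations are carried: a `p`-free pair needs the original one, to which `Nec∀` applies
  -- directly, and the remaining pairs use the translated one.
  D-[∀] : ∀ θ → ⊢ θ → ⊢ (h ⇒ tr θ) → (v : View ⊤' θ) → ⊢ (h ⇒ Dᵛ ⊤' θ v)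
  D-[∀] θ ⊢θ _ (free _ _) = weaken (Nec∀ ⊢θ)
  D-[∀] ⊤' _ ⊢tr (special ⊤-right) = ⊢tr
  D-[∀] (θ ∧' θ′) ⊢θ ⊢tr (special ∧-right) = ∧-intro-⇒
    (D-[∀] θ (MP ∧-fst ⊢θ) (⇒-trans ⊢tr ∧-fst) (view _ _))
    (D-[∀] θ′ (MP ∧-snd ⊢θ) (⇒-trans ⊢tr ∧-snd) (view _ _))
  D-[∀] (c ↝ d) _ ⊢tr (special [∀]↝) = ⊢tr
  D-[∀] (¬' (⊤' ↝ c)) _ ⊢tr (special [∀]¬[∀]) = ⊢tr
  D-[∀] θ _ ⊢tr (other _ _ _) = weaken (Nec∀ (⇒-swap (weaken ⊢tr)))

  tr-sound : ∀ {θ} → ⊢ θ → ⊢ (h ⇒ tr θ)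
  tr-sound (taut τ σ ok) rewrite tr-inst σ τ = weaken (taut τ (tr ∘ σ) ok)
  tr-sound (A1 a) = weaken (∧-intro (D-⊥ a (view _ _)) (D-⊤ a (view _ _)))
  tr-sound (A2 a b c) = weaken (D-∨ a b c (view _ _))
  tr-sound (A3 a b c) = weaken (D-∧ a b c (view _ _))
  tr-sound (A4 a b) = D-reflexive a b (view _ _)
  tr-sound (A5 a b) = weaken (D-contra a b (view _ _))
  -- `[∀] a` is `⊤' ↝ a`, so A8 is one half of an instance of A10.
  tr-sound (A8 a) = weaken (⇔-to (D-[∀]↝ ⊤' a (view _ _)))
  tr-sound (A9 a) = weaken (D-[∀]¬[∀] a (view _ _))
  tr-sound (A10 a b) = weaken (D-[∀]↝ a b (view _ _))
  tr-sound (A11 a) = weaken (D-¬[∀]-refuted a (view _ _))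
  tr-sound (K a b) = weaken (K (tr a) (tr b))
  tr-sound (Add a b) = weaken (D-□ a b (view _ _))
  tr-sound (MP f x) = ⇒-app (tr-sound f) (tr-sound x)
  tr-sound (Nec∀ {θ} x) = D-[∀] θ x (tr-sound x) (view _ _)
  tr-sound (Nec□ x) = ⇒-trans h-persistent (□-mono (tr-sound x))

  -- The antecedent of the premise

  -- Generalised from `φ` to any `x` implying it, since splitting a disjunction leaves disjuncts
  -- that still imply `φ`. An irreducible pair becomes `[∀] (h ⇒ x ⇒ φ)`.
  D-var-right : ∀ x → ¬ Occurs p x → ⊢ (x ⇒ φ) → (v : View x (var p)) → ⊢ Dᵛ x (var p) v
  D-var-right x _ _ (free _ ∉p) = contradiction here ∉p
  D-var-right ⊥' _ _ (special ⊥-left) = ⊢⊤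
  D-var-right (x ∨' y) ∉ x∨y⇒φ (special ∨-left) = ∧-intro
    (D-var-right x (∉ ∘ ∨l) (⇒-trans ∨-inl x∨y⇒φ) (view _ _))
    (D-var-right y (∉ ∘ ∨r) (⇒-trans ∨-inr x∨y⇒φ) (view _ _))
  D-var-right x ∉ x⇒φ (other _ _ _)
    rewrite tr-free x ∉ | tr-var-p = Nec∀ (weaken x⇒φ)

  -- Dually, conjuncts of `ψ` are still implied by `ψ`. An irreducible pair becomes
  -- `[∀] (h ⇒ φ ⇒ y)`, where A4 for the guard supplies the step from `φ` to `ψ`.
  D-var-left : ∀ y → ¬ Occurs p y → ⊢ (ψ ⇒ y) → (v : View (var p) y) → ⊢ Dᵛ (var p) y v
  D-var-left y _ _ (free ∉p _) = contradiction here ∉p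
  D-var-left ⊤' _ _ (special ⊤-right) = ⊢⊤
  D-var-left (x ∧' y) ∉ ψ⇒x∧y (special ∧-right) = ∧-intro
    (D-var-left x (∉ ∘ ∧l) (⇒-trans ψ⇒x∧y ∧-fst) (view _ _))
    (D-var-left y (∉ ∘ ∧r) (⇒-trans ψ⇒x∧y ∧-snd) (view _ _))
  D-var-left y ∉ ψ⇒y (other _ _ _)
    rewrite tr-free y ∉ | tr-var-p = Nec∀ (⇒-trans₂ (A4 φ ψ) ψ⇒y)

theorem4p11 : (φ ψ χ : Fm) (p : ℕ) →
    ¬ Occurs p φ → ¬ Occurs p ψ → ¬ Occurs p χ →
    ⊢ (((φ ↝ var p) ∧' (var p ↝ ψ)) ⇒ χ) →
    ⊢ ((φ ↝ ψ) ⇒ χ)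
theorem4p11 φ ψ χ p ∉φ ∉ψ ∉χ premise =
  subst (λ θ → ⊢ ((φ ↝ ψ) ⇒ θ)) (tr-free χ ∉χ)
    (⇒-app (tr-sound premise)
      (weaken (∧-intro (D-var-right φ ∉φ ⇒-refl (view _ _))
                       (D-var-left ψ ∉ψ ⇒-refl (view _ _)))))
  where open Translation p φ ψ
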